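{- Let $G$ be an $n$-vertex symmetric directed graph, let $\bowtie$ be a balanced equivalence relation on the vertices of $G$, and let $Q=G/\bowtie$ be the associated quotient graph, with $m$ vertices, where $m<n$. Then $Q$ is symmetric if and only if, for each pair of connected vertices of $Q$, the corresponding $\bowtie$-classes on the set of vertices of $G$ have the same cardinality.
   Context: Directed graphs are finite and may have loops and multiple edges. The adjacency matrix of a directed graph with vertices $1,\ldots,n$ is the $n\times n$ matrix of non-negative integers whose $(i,j)$ entry is the number of directed edges from vertex $j$ to vertex $i$. A directed graph is symmetric (bidirected) if its adjacency matrix is symmetric. An equivalence relation $\bowtie$ on the vertex set of a directed graph $G$ is balanced if, for any two vertices $u,v$ in the same $\bowtie$-class and any $\bowtie$-class $C$, the number of directed edges from vertices of $C$ to $u$ equals the number of directed edges from vertices of $C$ to $v$. For a balanced $\bowtie$ with classes $I_1,\ldots,I_m$, the quotient graph $G/\bowtie$ has one vertex for each class, and its edges are the projections of the edges of $G$: its adjacency matrix $[q_{ij}]_{m\times m}$ is given by letting $q_{ij}$ be the number of directed edges of $G$ from vertices of $I_j$ to any given vertex of $I_i$ (well defined since $\bowtie$ is balanced). A pair of vertices $i,j$ of $Q$ is called connected if there is an edge of $Q$ between them, i.e. $q_{ij}\neq 0$ or $q_{ji}\neq 0$ (when $G$ is symmetric, these two conditions are equivalent). -}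

module Defs where

open import Data.Bool using (true; false)
open import Data.Empty using (⊥-elim)
open import Data.Fin using (Fin; zero; suc; _≟_)
open import Data.Fin.Properties using (any?; suc-injective)
open import Data.List using (List; []; _∷_; length; filter; map; allFin)
open import Data.Nat using (ℕ; zero; suc)
open import Data.Product using (_×_; _,_; proj₁; proj₂; ∃)
import Data.Product as Product
open import Data.Sum using (_⊎_)
open import Function using (_∘_; _⇔_; mk⇔; Equivalence; StrictlySurjective)
open import Level using (Level)
open import Relation.Binary using (Rel; IsDecEquivalence)
open import Relation.Binary.PropositionalEquality
  using (_≡_; _≢_; refl; sym; trans; cong; module ≡-Reasoning)
open import Relation.Nullary using (yes; no; does)
open import Relation.Nullary.Decidable using (_×-dec_; does-⇔; dec-false)
open import Relation.Unary using (Pred; Decidable)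

private variable
  ℓ p q : Level
  A : Set
  m n : ℕ

-- A finite directed multigraph on the vertices Fin n.  The edges are listed
-- as (source , target) pairs; loops and repetitions are allowed.
record Digraph (n : ℕ) : Set where
  constructor digraph
  field
    edges : List (Fin n × Fin n)

open Digraph public

edgesFrom_to_inside_ : {P : Pred (Fin n) p} → Decidable P → Fin n → Digraph n → ℕ
edgesFrom P? to u inside G =
  length (filter (λ e → P? (proj₁ e) ×-dec (proj₂ e ≟ u)) (edges G))

-- Row index = target, column index = source.
adjacency : Digraph n → Fin n → Fin n → ℕ
adjacency G i j = edgesFrom (_≟ j) to i inside G

Symmetric : Digraph n → Set
Symmetric G = ∀ i j → adjacency G i j ≡ adjacency G j i

Connected : Digraph n → Rel (Fin n) _
Connected G i j = adjacency G i j ≢ 0 ⊎ adjacency G j i ≢ 0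

-- Every class is the class { v | w ⋈ v } of some vertex w.
Balanced : Digraph n → {_⋈_ : Rel (Fin n) ℓ} → IsDecEquivalence _⋈_ → Set ℓ
Balanced G {_⋈_} isDecEq = ∀ {u v} → u ⋈ v → ∀ w →
  edgesFrom (w ⋈?_) to u inside G ≡ edgesFrom (w ⋈?_) to v inside G
  where open IsDecEquivalence isDecEq renaming (_≟_ to _⋈?_)

-- A numbering I₁,…,Iₘ of the classes of ⋈: the vertex v lies in the class
-- numbered `class v`, and surjectivity says that no class is empty.
-- `enumerateClasses` below shows that a numbering always exists.
record Classes {n} (_⋈_ : Rel (Fin n) ℓ) (m : ℕ) : Set ℓ where
  field
    class            : Fin n → Fin m
    ⋈⇔class-≡        : ∀ {u v} → u ⋈ v ⇔ class u ≡ class v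
    class-surjective : StrictlySurjective _≡_ class

  representative : Fin m → Fin n
  representative = proj₁ ∘ class-surjective

  cardinality : Fin m → ℕ
  cardinality i = length (filter (λ v → class v ≟ i) (allFin n))

open Classes public

-- Only the edges entering the chosen representative of each class are
-- projected, so that an edge is counted once per class rather than once per
-- vertex of the target class; `adjacency-quotient` below shows that the choice
-- of representatives does not matter for a balanced ⋈.
quotient : Digraph n → {_⋈_ : Rel (Fin n) ℓ} → Classes _⋈_ m → Digraph m
quotient G I = digraph (map (Product.map (class I) (class I))
  (filter (λ e → proj₂ e ≟ representative I (class I (proj₂ e))) (edges G)))

private
  filter-length-⇔ : {P : Pred A p} {Q : Pred A q} (P? : Decidable P) (Q? : Decidable Q) →
    (∀ x → P x ⇔ Q x) → ∀ xs → length (filter P? xs) ≡ length (filter Q? xs)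
  filter-length-⇔ P? Q? eq [] = refl
  filter-length-⇔ P? Q? eq (x ∷ xs)
    with does (P? x) | does (Q? x) | does-⇔ (eq x) (P? x) (Q? x)
  ... | true  | .true  | refl = cong suc (filter-length-⇔ P? Q? eq xs)
  ... | false | .false | refl = filter-length-⇔ P? Q? eq xs

module _ (G : Digraph n) {_⋈_ : Rel (Fin n) ℓ} (isDecEq : IsDecEquivalence _⋈_)
         (I : Classes _⋈_ m) where

  open IsDecEquivalence isDecEq using () renaming (_≟_ to _⋈?_)

  private
    rep : Fin m → Fin n
    rep = representative I

    class-rep : ∀ i → class I (rep i) ≡ i
    class-rep = proj₂ ∘ class-surjective I

    toClass : ∀ j v → (rep j ⋈ v) ⇔ (class I v ≡ j)
    toClass j v = mk⇔
      (λ r → trans (sym (Equivalence.to (⋈⇔class-≡ I) r)) (class-rep j))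
      (λ e → Equivalence.from (⋈⇔class-≡ I) (trans (class-rep j) (sym e)))

    edgesFrom-class : ∀ j u → edgesFrom (rep j ⋈?_) to u inside G
                            ≡ edgesFrom (λ v → class I v ≟ j) to u inside G
    edgesFrom-class j u = filter-length-⇔ _ _ (λ (s , t) → mk⇔
      (Product.map₁ (Equivalence.to (toClass j s)))
      (Product.map₁ (Equivalence.from (toClass j s)))) (edges G)

    adjacency-rep : ∀ i j → adjacency (quotient G I) i j
                          ≡ edgesFrom (λ v → class I v ≟ j) to rep i inside G
    adjacency-rep i j = go (edges G)
      where
      Hit? : Decidable (λ (e : Fin n × Fin n) → class I (proj₁ e) ≡ j × proj₂ e ≡ rep i)
      Hit? e = (class I (proj₁ e) ≟ j) ×-dec (proj₂ e ≟ rep i)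
      Kept? : Decidable (λ (e : Fin n × Fin n) → proj₂ e ≡ rep (class I (proj₂ e)))
      Kept? e = proj₂ e ≟ rep (class I (proj₂ e))
      Ends? : Decidable (λ (e : Fin m × Fin m) → proj₁ e ≡ j × proj₂ e ≡ i)
      Ends? e = (proj₁ e ≟ j) ×-dec (proj₂ e ≟ i)

      go : ∀ es → length (filter Ends? (map (Product.map (class I) (class I)) (filter Kept? es)))
                ≡ length (filter Hit? es)
      go [] = refl
      go (e@(s , t) ∷ es) with Kept? e
      go (e@(s , t) ∷ es) | yes k
        with does (Ends? (class I s , class I t)) | does (Hit? e)
           | does-⇔ (mk⇔ (Product.map₂ (λ ct → trans k (cong rep ct)))
                         (Product.map₂ (λ tr → trans (cong (class I) tr) (class-rep i))))
                    (Ends? (class I s , class I t)) (Hit? e)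
      ... | true  | .true  | refl = cong suc (go es)
      ... | false | .false | refl = go es
      go (e@(s , t) ∷ es) | no ¬k
        with does (Hit? e)
           | dec-false (Hit? e) (λ (_ , tr) → ¬k (trans tr (cong rep
               (trans (sym (class-rep i)) (cong (class I) (sym tr))))))
      ... | .false | refl = go es

  adjacency-quotient : Balanced G isDecEq → ∀ {i} j {u} → class I u ≡ i →
    adjacency (quotient G I) i j ≡ edgesFrom (λ v → class I v ≟ j) to u inside G
  adjacency-quotient balanced {i} j {u} u∈i = begin
    adjacency (quotient G I) i j                         ≡⟨ adjacency-rep i j ⟩
    edgesFrom (λ v → class I v ≟ j) to rep i inside G    ≡⟨ edgesFrom-class j (rep i) ⟨
    edgesFrom (rep j ⋈?_) to rep i inside G              ≡⟨ balanced (Equivalence.from (toClass i u) u∈i) (rep j) ⟩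
    edgesFrom (rep j ⋈?_) to u inside G                  ≡⟨ edgesFrom-class j u ⟩
    edgesFrom (λ v → class I v ≟ j) to u inside G        ∎
    where open ≡-Reasoning

enumerateClasses : {_⋈_ : Rel (Fin n) ℓ} → IsDecEquivalence _⋈_ → ∃ (Classes _⋈_)
enumerateClasses {n = zero} _ = 0 , record
  { class = λ () ; ⋈⇔class-≡ = λ { {()} } ; class-surjective = λ () }
enumerateClasses {n = suc n} {_⋈_ = _⋈_} isDecEq
  with enumerateClasses {_⋈_ = λ u v → suc u ⋈ suc v} (record
         { isEquivalence = record { refl = E.refl ; sym = E.sym ; trans = E.trans }
         ; _≟_ = λ u v → suc u E.≟ suc v })
     | any? (λ v → zero E.≟ suc v)
  where module E = IsDecEquivalence isDecEq
... | m , I | yes (w , 0⋈w) = m , record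
  { class = cl
  ; ⋈⇔class-≡ = λ {u} {v} → mk⇔ (to u v) (from u v)
  ; class-surjective = λ i → Product.map suc (λ e → e) (class-surjective I i)
  }
  where
  module E = IsDecEquivalence isDecEq
  cl : Fin (suc n) → Fin m
  cl zero    = class I w
  cl (suc v) = class I v
  to : ∀ u v → u ⋈ v → cl u ≡ cl v
  to zero    zero    _ = refl
  to zero    (suc v) r = Equivalence.to (⋈⇔class-≡ I) (E.trans (E.sym 0⋈w) r)
  to (suc u) zero    r = Equivalence.to (⋈⇔class-≡ I) (E.trans r 0⋈w)
  to (suc u) (suc v) r = Equivalence.to (⋈⇔class-≡ I) r
  from : ∀ u v → cl u ≡ cl v → u ⋈ v
  from zero    zero    _ = E.refl
  from zero    (suc v) e = E.trans 0⋈w (Equivalence.from (⋈⇔class-≡ I) e)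
  from (suc u) zero    e = E.trans (Equivalence.from (⋈⇔class-≡ I) e) (E.sym 0⋈w)
  from (suc u) (suc v) e = Equivalence.from (⋈⇔class-≡ I) e
... | m , I | no 0⋈̸ = suc m , record
  { class = cl
  ; ⋈⇔class-≡ = λ {u} {v} → mk⇔ (to u v) (from u v)
  ; class-surjective = λ { zero → zero , refl
                         ; (suc i) → Product.map suc (cong suc) (class-surjective I i) }
  }
  where
  module E = IsDecEquivalence isDecEq
  cl : Fin (suc n) → Fin (suc m)
  cl zero    = zero
  cl (suc v) = suc (class I v)
  to : ∀ u v → u ⋈ v → cl u ≡ cl v
  to zero    zero    _ = refl
  to zero    (suc v) r = ⊥-elim (0⋈̸ (v , r))
  to (suc u) zero    r = ⊥-elim (0⋈̸ (u , E.sym r))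
  to (suc u) (suc v) r = cong suc (Equivalence.to (⋈⇔class-≡ I) r)
  from : ∀ u v → cl u ≡ cl v → u ⋈ v
  from zero    zero    _ = E.refl
  from (suc u) (suc v) e = Equivalence.from (⋈⇔class-≡ I) (suc-injective e)

{-# OPTIONS --safe #-}
-- Counting the edges of G from I_j to I_i by their target gives |I_i| · q_ij;
-- since G is symmetric this number is unchanged when i and j are exchanged,
-- so |I_i| · q_ij = |I_j| · q_ji, and both implications follow by cancellation.
module Submission where

open import Defs
open import Algebra.Properties.CommutativeSemigroup using (x∙yz≈y∙xz)
open import Data.Bool using (true; false; if_then_else_)
open import Data.Fin using (Fin; zero; suc; _≟_)
open import Data.List using (List; []; _∷_; length; filter; tabulate)
open import Data.List.Membership.Propositional.Properties using (∈-allFin; ∈-filter⁺; ∈-length)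
open import Data.Nat using (ℕ; zero; suc; _+_; _*_; _<_; NonZero; >-nonZero; ≢-nonZero)
import Data.Nat as ℕ
open import Data.Nat.Properties
  using ( +-*-semiring; *-commutativeSemigroup; +-identityʳ; *-identityˡ; *-identityʳ; *-zeroʳ
        ; *-assoc; *-distribˡ-+; *-cancelˡ-≡; *-cancelʳ-≡ )
open import Data.Product using (_×_; _,_; proj₂)
open import Data.Sum using (inj₁; inj₂; [_,_]′)
open import Function using (_⇔_; mk⇔; id; _∘_)
open import Level using (Level)
open import Relation.Binary using (Rel; IsDecEquivalence)
open import Relation.Binary.PropositionalEquality
  using (_≡_; _≢_; refl; sym; trans; cong; cong₂; module ≡-Reasoning)
open import Relation.Nullary using (Dec; yes; no; does)
open import Relation.Nullary.Decidable using (_×-dec_)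
open import Relation.Unary using (Pred; Decidable)

open import Algebra.Properties.Semiring.Sum +-*-semiring
  using (sum-cong-≗; ∑-distrib-+; ∑-comm; *-distribˡ-sum; *-distribʳ-sum)
  renaming (sum to ∑)

open ≡-Reasoning

private variable
  a p q : Level
  A : Set a
  m n : ℕ

-- The Iverson bracket. It turns lengths of filtered lists into sums over all vertices, where the
-- order of summation can be exchanged.
𝟙 : {P : Set p} → Dec P → ℕ
𝟙 P? = if does P? then 1 else 0

𝟙-× : {P : Set p} {Q : Set q} (P? : Dec P) (Q? : Dec Q) → 𝟙 (P? ×-dec Q?) ≡ 𝟙 P? * 𝟙 Q?
𝟙-× P? Q? with does P?
... | false = refl
... | true  = sym (*-identityˡ (𝟙 Q?))

-- Allows an equation valid only for the vertices of one class to be used under a sum over all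
-- vertices: outside the class both sides vanish.
𝟙-*-cong : {P : Set p} (P? : Dec P) {x y : ℕ} → (P → x ≡ y) → 𝟙 P? * x ≡ 𝟙 P? * y
𝟙-*-cong (no _)  x≡y = refl
𝟙-*-cong (yes p) x≡y = cong (1 *_) (x≡y p)

length-filter-∷ : {P : Pred A p} (P? : Decidable P) (x : A) (xs : List A) →
  length (filter P? (x ∷ xs)) ≡ 𝟙 (P? x) + length (filter P? xs)
length-filter-∷ P? x xs with does (P? x)
... | false = refl
... | true  = refl

length-filter-tabulate : {P : Pred A p} (P? : Decidable P) (f : Fin n → A) →
  length (filter P? (tabulate f)) ≡ ∑ (λ k → 𝟙 (P? (f k)))
length-filter-tabulate {n = zero}  P? f = refl
length-filter-tabulate {n = suc n} P? f = trans
  (length-filter-∷ P? (f zero) (tabulate (f ∘ suc)))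
  (cong (𝟙 (P? (f zero)) +_) (length-filter-tabulate P? (f ∘ suc)))

∑-𝟙-≟ : (f : Fin n → ℕ) (s : Fin n) → ∑ (λ v → f v * 𝟙 (s ≟ v)) ≡ f s
∑-𝟙-≟ f zero = begin
  f zero * 1 + ∑ (λ v → f (suc v) * 0) ≡⟨ cong₂ _+_ (*-identityʳ (f zero)) (sym (*-distribʳ-sum 0 (f ∘ suc))) ⟩
  f zero + ∑ (f ∘ suc) * 0             ≡⟨ cong (f zero +_) (*-zeroʳ (∑ (f ∘ suc))) ⟩
  f zero + 0                           ≡⟨ +-identityʳ (f zero) ⟩
  f zero                               ∎
-- The test `suc s ≟ suc v` has the same truth value as `s ≟ v` by computation, so the tail is
-- literally the induction hypothesis.
∑-𝟙-≟ f (suc s) = cong₂ _+_ (*-zeroʳ (f zero)) (∑-𝟙-≟ (f ∘ suc) s)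

-- Every edge has exactly one source, so the edges into `u` can be grouped by source. The induction
-- is on the edge list, hence the explicit `digraph es`.
edgesFrom-∑ : {P : Pred (Fin n) p} (P? : Decidable P) (u : Fin n) (es : List (Fin n × Fin n)) →
  edgesFrom P? to u inside digraph es ≡ ∑ (λ v → 𝟙 (P? v) * adjacency (digraph es) u v)
edgesFrom-∑ P? u [] = begin
  0                          ≡⟨ *-zeroʳ (∑ (𝟙 ∘ P?)) ⟨
  ∑ (λ v → 𝟙 (P? v)) * 0     ≡⟨ *-distribʳ-sum 0 (𝟙 ∘ P?) ⟩
  ∑ (λ v → 𝟙 (P? v) * 0)     ∎
edgesFrom-∑ P? u (e@(s , t) ∷ es) = begin
  edgesFrom P? to u inside digraph (e ∷ es)
    ≡⟨ length-filter-∷ _ e es ⟩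
  𝟙 (P? s ×-dec (t ≟ u)) + edgesFrom P? to u inside digraph es
    ≡⟨ cong₂ _+_ (𝟙-× (P? s) (t ≟ u)) (edgesFrom-∑ P? u es) ⟩
  𝟙 (P? s) * 𝟙 (t ≟ u) + ∑ (λ v → 𝟙 (P? v) * N v)
    -- The contribution of the head edge is spread over all `v`, with only `v = s` contributing, so
    -- that it can be merged termwise with the sum for the remaining edges.
    ≡⟨ cong (λ x → x * 𝟙 (t ≟ u) + ∑ (λ v → 𝟙 (P? v) * N v)) (∑-𝟙-≟ (𝟙 ∘ P?) s) ⟨
  ∑ (λ v → 𝟙 (P? v) * 𝟙 (s ≟ v)) * 𝟙 (t ≟ u) + ∑ (λ v → 𝟙 (P? v) * N v)
    ≡⟨ cong (_+ ∑ (λ v → 𝟙 (P? v) * N v)) (*-distribʳ-sum (𝟙 (t ≟ u)) (λ v → 𝟙 (P? v) * 𝟙 (s ≟ v))) ⟩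
  ∑ (λ v → 𝟙 (P? v) * 𝟙 (s ≟ v) * 𝟙 (t ≟ u)) + ∑ (λ v → 𝟙 (P? v) * N v)
    ≡⟨ ∑-distrib-+ (λ v → 𝟙 (P? v) * 𝟙 (s ≟ v) * 𝟙 (t ≟ u)) (λ v → 𝟙 (P? v) * N v) ⟨
  ∑ (λ v → 𝟙 (P? v) * 𝟙 (s ≟ v) * 𝟙 (t ≟ u) + 𝟙 (P? v) * N v)
    ≡⟨ sum-cong-≗ collect ⟩
  ∑ (λ v → 𝟙 (P? v) * adjacency (digraph (e ∷ es)) u v) ∎
  where
  N : Fin _ → ℕ
  N = adjacency (digraph es) u

  collect : ∀ v → 𝟙 (P? v) * 𝟙 (s ≟ v) * 𝟙 (t ≟ u) + 𝟙 (P? v) * N v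
                ≡ 𝟙 (P? v) * adjacency (digraph (e ∷ es)) u v
  collect v = begin
    𝟙 (P? v) * 𝟙 (s ≟ v) * 𝟙 (t ≟ u) + 𝟙 (P? v) * N v
      ≡⟨ cong (_+ 𝟙 (P? v) * N v) (*-assoc (𝟙 (P? v)) (𝟙 (s ≟ v)) (𝟙 (t ≟ u))) ⟩
    𝟙 (P? v) * (𝟙 (s ≟ v) * 𝟙 (t ≟ u)) + 𝟙 (P? v) * N v
      ≡⟨ *-distribˡ-+ (𝟙 (P? v)) (𝟙 (s ≟ v) * 𝟙 (t ≟ u)) (N v) ⟨
    𝟙 (P? v) * (𝟙 (s ≟ v) * 𝟙 (t ≟ u) + N v)
      ≡⟨ cong (λ x → 𝟙 (P? v) * (x + N v)) (𝟙-× (s ≟ v) (t ≟ u)) ⟨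
    𝟙 (P? v) * (𝟙 ((s ≟ v) ×-dec (t ≟ u)) + N v)
      ≡⟨ cong (𝟙 (P? v) *_) (length-filter-∷ _ e es) ⟨
    𝟙 (P? v) * adjacency (digraph (e ∷ es)) u v ∎

module _ {ℓ} {_⋈_ : Rel (Fin n) ℓ} (I : Classes _⋈_ m) where

  -- The representative of a class belongs to it. This licenses cancelling the class size in
  -- `equal-entries`.
  cardinality-nonZero : ∀ i → NonZero (cardinality I i)
  cardinality-nonZero i = >-nonZero (∈-length
    (∈-filter⁺ (λ v → class I v ≟ i) (∈-allFin (representative I i)) (proj₂ (class-surjective I i))))

  module _ (G : Digraph n) (isDecEq : IsDecEquivalence _⋈_) (balanced : Balanced G isDecEq) where

    cardinality-*-adjacency : ∀ i j → cardinality I i * adjacency (quotient G I) i j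
      ≡ ∑ (λ u → ∑ (λ v → 𝟙 (class I u ≟ i) * (𝟙 (class I v ≟ j) * adjacency G u v)))
    cardinality-*-adjacency i j = begin
      cardinality I i * qᵢⱼ
        ≡⟨ cong (_* qᵢⱼ) (length-filter-tabulate (λ v → class I v ≟ i) id) ⟩
      ∑ (λ u → 𝟙 (class I u ≟ i)) * qᵢⱼ
        ≡⟨ *-distribʳ-sum qᵢⱼ (λ u → 𝟙 (class I u ≟ i)) ⟩
      ∑ (λ u → 𝟙 (class I u ≟ i) * qᵢⱼ)
        -- Balance enters here: each `u` in class `i`, not just the representative, receives `qᵢⱼ`
        -- edges from class `j`.
        ≡⟨ sum-cong-≗ (λ u → 𝟙-*-cong (class I u ≟ i) (adjacency-quotient G isDecEq I balanced j)) ⟩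
      ∑ (λ u → 𝟙 (class I u ≟ i) * edgesFrom (λ v → class I v ≟ j) to u inside G)
        ≡⟨ sum-cong-≗ (λ u → cong (𝟙 (class I u ≟ i) *_) (edgesFrom-∑ (λ v → class I v ≟ j) u (edges G))) ⟩
      ∑ (λ u → 𝟙 (class I u ≟ i) * ∑ (λ v → 𝟙 (class I v ≟ j) * adjacency G u v))
        ≡⟨ sum-cong-≗ (λ u → *-distribˡ-sum (𝟙 (class I u ≟ i)) (λ v → 𝟙 (class I v ≟ j) * adjacency G u v)) ⟩
      ∑ (λ u → ∑ (λ v → 𝟙 (class I u ≟ i) * (𝟙 (class I v ≟ j) * adjacency G u v))) ∎
      where
      qᵢⱼ : ℕ
      qᵢⱼ = adjacency (quotient G I) i j

    cardinality-*-adjacency-comm : Symmetric G → ∀ i j →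
      cardinality I i * adjacency (quotient G I) i j ≡ cardinality I j * adjacency (quotient G I) j i
    cardinality-*-adjacency-comm symmetric i j = begin
      cardinality I i * adjacency (quotient G I) i j
        ≡⟨ cardinality-*-adjacency i j ⟩
      ∑ (λ u → ∑ (λ v → 𝟙 (class I u ≟ i) * (𝟙 (class I v ≟ j) * adjacency G u v)))
        ≡⟨ ∑-comm (λ u v → 𝟙 (class I u ≟ i) * (𝟙 (class I v ≟ j) * adjacency G u v)) ⟩
      ∑ (λ v → ∑ (λ u → 𝟙 (class I u ≟ i) * (𝟙 (class I v ≟ j) * adjacency G u v)))
        -- Swapping the two indicators and transposing the entry of `G` yields the double sum for
        -- the pair `j`, `i`, up to the names of the bound variables.
        ≡⟨ sum-cong-≗ (λ v → sum-cong-≗ (λ u → trans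
             (x∙yz≈y∙xz *-commutativeSemigroup (𝟙 (class I u ≟ i)) (𝟙 (class I v ≟ j)) (adjacency G u v))
             (cong (λ x → 𝟙 (class I v ≟ j) * (𝟙 (class I u ≟ i) * x)) (symmetric u v)))) ⟩
      ∑ (λ v → ∑ (λ u → 𝟙 (class I v ≟ j) * (𝟙 (class I u ≟ i) * adjacency G v u)))
        ≡⟨ cardinality-*-adjacency j i ⟨
      cardinality I j * adjacency (quotient G I) j i ∎

theorem2p6 : ∀ {ℓ : Level} {n m : ℕ} (G : Digraph n) → Symmetric G →
    {_⋈_ : Rel (Fin n) ℓ} (⋈-isDecEquivalence : IsDecEquivalence _⋈_) → Balanced G ⋈-isDecEquivalence →
    (I : Classes _⋈_ m) → m < n →
    Symmetric (quotient G I) ⇔ (∀ i j → Connected (quotient G I) i j → cardinality I i ≡ cardinality I j)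
theorem2p6 {m = m} G symmetric isDecEq balanced I _ = mk⇔ equal-cardinalities quotient-symmetric
  where
  Q : Digraph m
  Q = quotient G I

  double-count : ∀ i j → cardinality I i * adjacency Q i j ≡ cardinality I j * adjacency Q j i
  double-count = cardinality-*-adjacency-comm I G isDecEq balanced symmetric

  equal-cardinalities : Symmetric Q → ∀ i j → Connected Q i j → cardinality I i ≡ cardinality I j
  equal-cardinalities Q-sym i j connected =
    *-cancelʳ-≡ _ _ (adjacency Q i j) {{≢-nonZero q≢0}}
      (trans (double-count i j) (cong (cardinality I j *_) (Q-sym j i)))
    where
    -- Connectedness only makes one of the two entries nonzero; symmetry of `Q` carries this over to
    -- the entry being cancelled.
    q≢0 : adjacency Q i j ≢ 0
    q≢0 = [ id , (λ q′≢0 q≡0 → q′≢0 (trans (Q-sym j i) q≡0)) ]′ connected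

  equal-entries : (∀ i j → Connected Q i j → cardinality I i ≡ cardinality I j) →
    ∀ i j → Connected Q i j → adjacency Q i j ≡ adjacency Q j i
  equal-entries equal i j connected =
    *-cancelˡ-≡ _ _ (cardinality I i) {{cardinality-nonZero I i}}
      (trans (double-count i j) (cong (_* adjacency Q j i) (sym (equal i j connected))))

  quotient-symmetric : (∀ i j → Connected Q i j → cardinality I i ≡ cardinality I j) → Symmetric Q
  -- The assumption says nothing about unconnected pairs, but there both entries are zero and hence
  -- agree.
  quotient-symmetric equal i j with adjacency Q i j ℕ.≟ 0 | adjacency Q j i ℕ.≟ 0
  ... | yes q≡0 | yes q′≡0 = trans q≡0 (sym q′≡0)
  ... | no q≢0  | _        = equal-entries equal i j (inj₁ q≢0)
  ... | yes _   | no q′≢0  = equal-entries equal i j (inj₂ q′≢0)
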